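{- A term $t\in\Lambda_{\mathsf{vsc}}$ is VSC-solvable if and only if it satisfies SOL-IN: there are a head context $H$ and an inert term $i$ such that $H\langle t\rangle \to_{\mathsf{vsc}}^* i$.
   Context: Value substitution calculus (VSC). Terms (the set $\Lambda_{\mathsf{vsc}}$) are $t,u,s ::= v \mid tu \mid t[x{\leftarrow}u]$ and values are $v ::= x \mid \lambda x.t$; $t[x{\leftarrow}u]$ is an explicit substitution (ES), binding $x$ in $t$. Terms are identified up to $\alpha$-renaming; $t\{x{\leftarrow}u\}$ is capture-avoiding (meta-level) substitution. Contexts are terms with exactly one hole $\langle\cdot\rangle$; plugging $C\langle t\rangle$ may capture variables. Substitution contexts: $L ::= \langle\cdot\rangle \mid L[x{\leftarrow}t]$. Root rules: $L\langle\lambda x.t\rangle u \mapsto_{\mathsf m} L\langle t[x{\leftarrow}u]\rangle$ and $t[x{\leftarrow}L\langle v\rangle] \mapsto_{\mathsf e} L\langle t\{x{\leftarrow}v\}\rangle$ with $v$ a value, where (by $\alpha$-renaming) $L$ captures no free variable of $u$, resp. of $t$. Full contexts: $F ::= \langle\cdot\rangle \mid Ft \mid tF \mid \lambda x.F \mid F[x{\leftarrow}t] \mid t[x{\leftarrow}F]$. The reduction $\to_{\mathsf{vsc}}$ is the closure of $\mapsto_{\mathsf m}\cup\mapsto_{\mathsf e}$ under full contexts. Head contexts: $H ::= \langle\cdot\rangle \mid \lambda x.H \mid Ht$ with $t\in\Lambda_{\mathsf{vsc}}$. A term $t$ is VSC-solvable if $H\langle t\rangle \to_{\mathsf{vsc}}^*\mathsf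 I=\lambda x.x$ for some head context $H$. Inert terms $i$ and fireballs $f$ are defined by mutual induction: $i,i' ::= x \mid i f \mid i[x{\leftarrow}i']$ and $f ::= v \mid i \mid f[x{\leftarrow}i]$, with $v$ any value. -}

module Defs where

open import Data.Bool.Base using (if_then_else_)
open import Data.Nat.Base using (ℕ; zero; suc; _+_)
open import Data.Nat.Properties using (_≟_)
open import Data.Product.Base using (∃-syntax; _×_)
open import Relation.Binary.Construct.Closure.ReflexiveTransitive using (Star)
open import Relation.Nullary.Decidable.Core using (does)

infixl 7 _·_
infixl 8 _[←_]
infixr 6 ƛ_ ƛ⟨_⟩_
infix  4 _↦m_ _↦e_ _→vsc_ _→vsc*_

-- Terms up to α-renaming, as de Bruijn terms: free variables are named by
-- natural numbers, and the name x occurs as index k + x under k binders.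
-- t [← u ] is the explicit substitution t[x←u]; it binds index 0 in t, not in u.
data Term : Set where
  var   : ℕ → Term
  ƛ_    : Term → Term
  _·_   : Term → Term → Term
  _[←_] : Term → Term → Term

data Value : Term → Set where
  var : ∀ x → Value (var x)
  ƛ_  : ∀ t → Value (ƛ t)

I : Term
I = ƛ var 0

ext : (ℕ → ℕ) → (ℕ → ℕ)
ext ρ zero    = zero
ext ρ (suc x) = suc (ρ x)

rename : (ℕ → ℕ) → Term → Term
rename ρ (var x)    = var (ρ x)
rename ρ (ƛ t)      = ƛ rename (ext ρ) t
rename ρ (t · u)    = rename ρ t · rename ρ u
rename ρ (t [← u ]) = rename (ext ρ) t [← rename ρ u ]

exts : (ℕ → Term) → (ℕ → Term)
exts σ zero    = var zero
exts σ (suc x) = rename suc (σ x)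

subst : (ℕ → Term) → Term → Term
subst σ (var x)    = σ x
subst σ (ƛ t)      = ƛ subst (exts σ) t
subst σ (t · u)    = subst σ t · subst σ u
subst σ (t [← u ]) = subst (exts σ) t [← subst σ u ]

single : Term → ℕ → Term
single u zero    = u
single u (suc x) = var x

-- Meta-level substitution t{x←u}, where x is index 0 of t.
_⟪_⟫ : Term → Term → Term
t ⟪ u ⟫ = subst (single u) t

data SubCtx : Set where
  □     : SubCtx
  _[←_] : SubCtx → Term → SubCtx

plugL : SubCtx → Term → Term
plugL □          t = t
plugL (L [← u ]) t = plugL L t [← u ]

depth : SubCtx → ℕ
depth □          = 0
depth (L [← _ ]) = suc (depth L)

-- A term moved inside L is shifted past the binders of L; this is what the
-- side condition that L captures none of its free variables amounts to.
data _↦m_ : Term → Term → Set where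
  root-m : ∀ L t u →
           plugL L (ƛ t) · u ↦m plugL L (t [← rename (depth L +_) u ])

-- Here index 0 of t is the variable being substituted, so only the other
-- indices of t are shifted.
data _↦e_ : Term → Term → Set where
  root-e : ∀ L t {v} → Value v →
           t [← plugL L v ] ↦e plugL L (rename (ext (depth L +_)) t ⟪ v ⟫)

data FullCtx : Set where
  □      : FullCtx
  _·ˡ_   : FullCtx → Term → FullCtx
  _·ʳ_   : Term → FullCtx → FullCtx
  ƛ_     : FullCtx → FullCtx
  _[←_]ˡ : FullCtx → Term → FullCtx
  _[←_]ʳ : Term → FullCtx → FullCtx

-- Capture is by index: the binders of F crossed on the way to the hole bind
-- the lowest indices of the plugged term.
plugF : FullCtx → Term → Term
plugF □           t = t
plugF (F ·ˡ u)    t = plugF F t · u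
plugF (u ·ʳ F)    t = u · plugF F t
plugF (ƛ F)       t = ƛ plugF F t
plugF (F [← u ]ˡ) t = plugF F t [← u ]
plugF (u [← F ]ʳ) t = u [← plugF F t ]

data _→vsc_ : Term → Term → Set where
  ctx-m : ∀ F {t u} → t ↦m u → plugF F t →vsc plugF F u
  ctx-e : ∀ F {t u} → t ↦e u → plugF F t →vsc plugF F u

_→vsc*_ : Term → Term → Set
_→vsc*_ = Star _→vsc_

bind : ℕ → ℕ → ℕ
bind x y = if does (y ≟ x) then 0 else suc y

-- The abstraction λx.t of an arbitrary free name x of t: x becomes index 0 and
-- every other name is shifted under the new binder.
lam : ℕ → Term → Term
lam x t = ƛ rename (bind x) t

-- Unlike in full contexts, where the plugged redex is arbitrary as well, binders
-- here carry a name: the term to be plugged is given, and a head context may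
-- capture any of its free variables, in any order.
data HeadCtx : Set where
  □     : HeadCtx
  ƛ⟨_⟩_ : ℕ → HeadCtx → HeadCtx
  _·_   : HeadCtx → Term → HeadCtx

plugH : HeadCtx → Term → Term
plugH □          t = t
plugH (ƛ⟨ x ⟩ H) t = lam x (plugH H t)
plugH (H · u)    t = plugH H t · u

data Inert    : Term → Set
data Fireball : Term → Set

data Inert where
  var   : ∀ x → Inert (var x)
  _·_   : ∀ {i f} → Inert i → Fireball f → Inert (i · f)
  _[←_] : ∀ {i i′} → Inert i → Inert i′ → Inert (i [← i′ ])

data Fireball where
  value : ∀ {v} → Value v → Fireball v
  inert : ∀ {i} → Inert i → Fireball i
  _[←_] : ∀ {f i} → Fireball f → Inert i → Fireball (f [← i ])

VSC-Solvable : Term → Set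
VSC-Solvable t = ∃[ H ] plugH H t →vsc* I

SOL-IN : Term → Set
SOL-IN t = ∃[ H ] ∃[ i ] Inert i × plugH H t →vsc* i

{-# OPTIONS --safe #-}

-- If H⟨t⟩ reduces to I, then H⟨t⟩ x reduces to the inert term x.
--
-- Conversely, abstract every free name of the inert term i and apply the result
-- to copies of λx₁…xₙ.I for a large n. An inert term has, possibly through a
-- chain of explicit substitutions, a free variable in head position. So, once
-- the names are filled, all fireballs inside i that are arguments or contents
-- of explicit substitutions evaluate to values and can be consumed, and i itself
-- evaluates to λx₁…xₘ.I for some m ≤ n. Applying it m times yields I.

module Submission where

open import Data.Bool.Base using (if_then_else_)
open import Data.Nat.Base
  using (ℕ; zero; suc; _+_; _≤_; _<_; s≤s; s≤s⁻¹)
open import Data.Nat.Properties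
  using (_≟_; ≤-refl; ≤-reflexive; ≤-trans; <⇒≢; m<1+n⇒m<n∨m≡n; n≤1+n;
         m≤m+n; m≤n+m; +-assoc; +-comm; +-identityʳ; +-suc)
open import Data.Product.Base using (∃-syntax; _×_; _,_)
open import Data.Sum.Base using (inj₁; inj₂)
open import Function.Base using (_∘_)
open import Function.Bundles using (_⇔_; mk⇔)
open import Relation.Binary.Construct.Closure.ReflexiveTransitive
  using (ε; _◅_; _◅◅_; gmap)
open import Relation.Binary.PropositionalEquality
  using (_≡_; _≢_; refl; sym; trans; cong; cong₂; subst₂; ≢-sym)
  renaming (subst to transport)
open import Relation.Nullary.Decidable using (dec-true; dec-false)
open import Defs

private
  variable
    t t′ u u′ v : Term
    ρ ρ′ ρ″ : ℕ → ℕ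
    σ τ υ : ℕ → Term

-- Renaming and substitution

rename-id : (∀ x → ρ x ≡ x) → ∀ t → rename ρ t ≡ t
ext-id : (∀ x → ρ x ≡ x) → ∀ x → ext ρ x ≡ x
ext-id h zero    = refl
ext-id h (suc x) = cong suc (h x)
rename-id h (var x)    = cong var (h x)
rename-id h (ƛ t)      = cong ƛ_ (rename-id (ext-id h) t)
rename-id h (t · u)    = cong₂ _·_ (rename-id h t) (rename-id h u)
rename-id h (t [← u ]) = cong₂ _[←_] (rename-id (ext-id h) t) (rename-id h u)

subst-id : (∀ x → σ x ≡ var x) → ∀ t → subst σ t ≡ t
exts-id : (∀ x → σ x ≡ var x) → ∀ x → exts σ x ≡ var x
exts-id h zero    = refl
exts-id h (suc x) = cong (rename suc) (h x)
subst-id h (var x)    = h x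
subst-id h (ƛ t)      = cong ƛ_ (subst-id (exts-id h) t)
subst-id h (t · u)    = cong₂ _·_ (subst-id h t) (subst-id h u)
subst-id h (t [← u ]) = cong₂ _[←_] (subst-id (exts-id h) t) (subst-id h u)

ext-ext : (∀ x → ρ′ (ρ x) ≡ ρ″ x) → ∀ x → ext ρ′ (ext ρ x) ≡ ext ρ″ x
ext-ext h zero    = refl
ext-ext h (suc x) = cong suc (h x)

rename-rename : (∀ x → ρ′ (ρ x) ≡ ρ″ x) →
                ∀ t → rename ρ′ (rename ρ t) ≡ rename ρ″ t
rename-rename h (var x)    = cong var (h x)
rename-rename h (ƛ t)      = cong ƛ_ (rename-rename (ext-ext h) t)
rename-rename h (t · u)    = cong₂ _·_ (rename-rename h t) (rename-rename h u)
rename-rename h (t [← u ]) =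
  cong₂ _[←_] (rename-rename (ext-ext h) t) (rename-rename h u)

exts-ext : (∀ x → σ (ρ x) ≡ τ x) → ∀ x → exts σ (ext ρ x) ≡ exts τ x
exts-ext h zero    = refl
exts-ext h (suc x) = cong (rename suc) (h x)

subst-rename : (∀ x → σ (ρ x) ≡ τ x) →
               ∀ t → subst σ (rename ρ t) ≡ subst τ t
subst-rename h (var x)    = h x
subst-rename h (ƛ t)      = cong ƛ_ (subst-rename (exts-ext h) t)
subst-rename h (t · u)    = cong₂ _·_ (subst-rename h t) (subst-rename h u)
subst-rename h (t [← u ]) =
  cong₂ _[←_] (subst-rename (exts-ext h) t) (subst-rename h u)

ext-exts : (∀ x → rename ρ (σ x) ≡ τ x) →
           ∀ x → rename (ext ρ) (exts σ x) ≡ exts τ x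
ext-exts         h zero    = refl
ext-exts {σ = σ} h (suc x) =
  trans (rename-rename (λ _ → refl) (σ x))
  (trans (sym (rename-rename (λ _ → refl) (σ x))) (cong (rename suc) (h x)))

rename-subst : (∀ x → rename ρ (σ x) ≡ τ x) →
               ∀ t → rename ρ (subst σ t) ≡ subst τ t
rename-subst h (var x)    = h x
rename-subst h (ƛ t)      = cong ƛ_ (rename-subst (ext-exts h) t)
rename-subst h (t · u)    = cong₂ _·_ (rename-subst h t) (rename-subst h u)
rename-subst h (t [← u ]) =
  cong₂ _[←_] (rename-subst (ext-exts h) t) (rename-subst h u)

exts-exts : (∀ x → subst τ (σ x) ≡ υ x) →
            ∀ x → subst (exts τ) (exts σ x) ≡ exts υ x
exts-exts         h zero    = refl
exts-exts {σ = σ} h (suc x) =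
  trans (subst-rename (λ _ → refl) (σ x))
  (trans (sym (rename-subst (λ _ → refl) (σ x))) (cong (rename suc) (h x)))

subst-subst : (∀ x → subst τ (σ x) ≡ υ x) →
              ∀ t → subst τ (subst σ t) ≡ subst υ t
subst-subst h (var x)    = h x
subst-subst h (ƛ t)      = cong ƛ_ (subst-subst (exts-exts h) t)
subst-subst h (t · u)    = cong₂ _·_ (subst-subst h t) (subst-subst h u)
subst-subst h (t [← u ]) =
  cong₂ _[←_] (subst-subst (exts-exts h) t) (subst-subst h u)

-- Reduction is a congruence and is stable under renaming

·ˡ-step : t →vsc t′ → t · u →vsc t′ · u
·ˡ-step (ctx-m F r) = ctx-m (F ·ˡ _) r
·ˡ-step (ctx-e F r) = ctx-e (F ·ˡ _) r

·ʳ-step : u →vsc u′ → t · u →vsc t · u′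
·ʳ-step (ctx-m F r) = ctx-m (_ ·ʳ F) r
·ʳ-step (ctx-e F r) = ctx-e (_ ·ʳ F) r

ƛ-step : t →vsc t′ → ƛ t →vsc ƛ t′
ƛ-step (ctx-m F r) = ctx-m (ƛ F) r
ƛ-step (ctx-e F r) = ctx-e (ƛ F) r

[←]ˡ-step : t →vsc t′ → t [← u ] →vsc t′ [← u ]
[←]ˡ-step (ctx-m F r) = ctx-m (F [← _ ]ˡ) r
[←]ˡ-step (ctx-e F r) = ctx-e (F [← _ ]ˡ) r

[←]ʳ-step : u →vsc u′ → t [← u ] →vsc t [← u′ ]
[←]ʳ-step (ctx-m F r) = ctx-m (_ [← F ]ʳ) r
[←]ʳ-step (ctx-e F r) = ctx-e (_ [← F ]ʳ) r

·-cong : t →vsc* t′ → u →vsc* u′ → t · u →vsc* t′ · u′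
·-cong ts us = gmap (_· _) ·ˡ-step ts ◅◅ gmap (_ ·_) ·ʳ-step us

-- Binders are crossed from the outermost inwards, the order in which a `SubCtx` is peeled in
-- `rename-plugL`.
ext^ : ℕ → (ℕ → ℕ) → ℕ → ℕ
ext^ zero    ρ = ρ
ext^ (suc d) ρ = ext^ d (ext ρ)

ext^-+ : ∀ d ρ x → ext^ d ρ (d + x) ≡ d + ρ x
ext^-+ zero    ρ x = refl
ext^-+ (suc d) ρ x =
  trans (cong (ext^ d (ext ρ)) (sym (+-suc d x)))
  (trans (ext^-+ d (ext ρ) (suc x)) (+-suc d (ρ x)))

renameL : (ℕ → ℕ) → SubCtx → SubCtx
renameL ρ □          = □
renameL ρ (L [← u ]) = renameL (ext ρ) L [← rename ρ u ]

depth-renameL : ∀ ρ L → depth (renameL ρ L) ≡ depth L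
depth-renameL ρ □          = refl
depth-renameL ρ (L [← u ]) = cong suc (depth-renameL (ext ρ) L)

rename-plugL : ∀ ρ L t → rename ρ (plugL L t) ≡
                         plugL (renameL ρ L) (rename (ext^ (depth L) ρ) t)
rename-plugL ρ □          t = refl
rename-plugL ρ (L [← u ]) t = cong _[← rename ρ u ] (rename-plugL (ext ρ) L t)

rename-Value : Value v → Value (rename ρ v)
rename-Value (var x) = var _
rename-Value (ƛ t)   = ƛ _

-- Renaming commutes with the shift past `L`: by `ext^-+`, shifted names lie above the binders of
-- `L` and move as they do outside.
rename-↦m : ∀ ρ → t ↦m u → rename ρ t ↦m rename ρ u
rename-↦m ρ (root-m L t u) =
  subst₂ _↦m_
    (cong (_· rename ρ u) (sym (rename-plugL ρ L (ƛ t))))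
    (trans (cong (λ s → plugL (renameL ρ L) (_ [← s ])) shift)
           (sym (rename-plugL ρ L _)))
    (root-m (renameL ρ L) _ (rename ρ u))
  where
  shift : rename (depth (renameL ρ L) +_) (rename ρ u) ≡
          rename (ext^ (depth L) ρ) (rename (depth L +_) u)
  shift rewrite depth-renameL ρ L =
    trans (rename-rename (λ x → sym (ext^-+ (depth L) ρ x)) u)
          (sym (rename-rename (λ _ → refl) u))

rename-↦e : ∀ ρ → t ↦e u → rename ρ t ↦e rename ρ u
rename-↦e ρ (root-e L t {v} val) =
  subst₂ _↦e_
    (cong (rename (ext ρ) t [←_]) (sym (rename-plugL ρ L v)))
    (trans (cong (plugL (renameL ρ L)) shift) (sym (rename-plugL ρ L _)))
    (root-e (renameL ρ L) (rename (ext ρ) t) (rename-Value val))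
  where
  ρᴸ = ext^ (depth L) ρ

  pointwise : ∀ x → single (rename ρᴸ v) (ext (depth L +_) (ext ρ x)) ≡
                    rename ρᴸ (single v (ext (depth L +_) x))
  pointwise zero    = refl
  pointwise (suc x) = cong var (sym (ext^-+ (depth L) ρ x))

  shift : rename (ext (depth (renameL ρ L) +_)) (rename (ext ρ) t)
            ⟪ rename ρᴸ v ⟫ ≡
          rename ρᴸ (rename (ext (depth L +_)) t ⟪ v ⟫)
  -- Each side is fused into a single substitution into `t`, and the two are compared index by
  -- index.
  shift rewrite depth-renameL ρ L =
    trans (subst-rename (λ _ → refl) (rename (ext ρ) t))
    (trans (subst-rename pointwise t)
    (trans (sym (rename-subst (λ _ → refl) t))
           (cong (rename ρᴸ) (sym (subst-rename (λ _ → refl) t)))))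

-- `lam x` renames its body by `bind x`, so reducing below a named binder of a head context rests on
-- this.
rename-step : ∀ ρ → t →vsc u → rename ρ t →vsc rename ρ u
rename-step ρ (ctx-m □ r)           = ctx-m □ (rename-↦m ρ r)
rename-step ρ (ctx-m (F ·ˡ u) r)    = ·ˡ-step (rename-step ρ (ctx-m F r))
rename-step ρ (ctx-m (t ·ʳ F) r)    = ·ʳ-step (rename-step ρ (ctx-m F r))
rename-step ρ (ctx-m (ƛ F) r)       = ƛ-step (rename-step (ext ρ) (ctx-m F r))
rename-step ρ (ctx-m (F [← u ]ˡ) r) = [←]ˡ-step (rename-step (ext ρ) (ctx-m F r))
rename-step ρ (ctx-m (t [← F ]ʳ) r) = [←]ʳ-step (rename-step ρ (ctx-m F r))
rename-step ρ (ctx-e □ r)           = ctx-e □ (rename-↦e ρ r)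
rename-step ρ (ctx-e (F ·ˡ u) r)    = ·ˡ-step (rename-step ρ (ctx-e F r))
rename-step ρ (ctx-e (t ·ʳ F) r)    = ·ʳ-step (rename-step ρ (ctx-e F r))
rename-step ρ (ctx-e (ƛ F) r)       = ƛ-step (rename-step (ext ρ) (ctx-e F r))
rename-step ρ (ctx-e (F [← u ]ˡ) r) = [←]ˡ-step (rename-step (ext ρ) (ctx-e F r))
rename-step ρ (ctx-e (t [← F ]ʳ) r) = [←]ʳ-step (rename-step ρ (ctx-e F r))

lam-cong : ∀ x → t →vsc* t′ → lam x t →vsc* lam x t′
lam-cong x = gmap (lam x) (ƛ-step ∘ rename-step (bind x))

-- With the empty substitution context, the shift in the root rule is an identity renaming, which
-- the transport removes.
es-step : ∀ t → Value v → t ⟪ v ⟫ ≡ u → t [← v ] →vsc u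
es-step {v} t val eq = transport (t [← v ] →vsc_)
  (trans (cong _⟪ v ⟫ (rename-id (ext-id (λ _ → refl)) t)) eq)
  (ctx-e □ (root-e □ t val))

β-value : ∀ t → Value v → t ⟪ v ⟫ ≡ u → (ƛ t) · v →vsc* u
β-value {v} t val eq =
  transport (λ s → (ƛ t) · v →vsc t [← s ])
    (rename-id (λ _ → refl) v) (ctx-m □ (root-m □ t v))
  ◅ es-step t val eq ◅ ε

-- Consumers

consumer : ℕ → Term
consumer zero    = I
consumer (suc n) = ƛ consumer n

consumer-Value : ∀ n → Value (consumer n)
consumer-Value zero    = ƛ _
consumer-Value (suc n) = ƛ _

subst-consumer : ∀ n → subst σ (consumer n) ≡ consumer n
subst-consumer zero    = refl
subst-consumer (suc n) = cong ƛ_ (subst-consumer n)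

consume : ∀ n → Value v → consumer (suc n) · v →vsc* consumer n
consume n val = β-value (consumer n) val (subst-consumer n)

-- Bounds both the names occurring outside abstractions and the number of
-- arguments consumed during the evaluation of an inert term.
weight : Term → ℕ
weight (var x)    = suc x
weight (ƛ t)      = 0
weight (t · u)    = suc (weight t + weight u)
weight (t [← u ]) = weight t + weight u

-- One bound `p` both limits the names and guarantees the capacity of their consumers, matching the
-- double role of `weight`.
Consuming : ℕ → (ℕ → Term) → Set
Consuming p σ = ∀ x → x < p → ∃[ m ] p ≤ m × σ x ≡ consumer m

infixr 5 _∷ₛ_

_∷ₛ_ : Term → (ℕ → Term) → ℕ → Term
(u ∷ₛ σ) zero    = u
(u ∷ₛ σ) (suc x) = σ x

subst-exts-⟪⟫ : ∀ t → subst (exts σ) t ⟪ u ⟫ ≡ subst (u ∷ₛ σ) t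
subst-exts-⟪⟫ {σ} {u} = subst-subst pointwise
  where
  pointwise : ∀ x → subst (single u) (exts σ x) ≡ (u ∷ₛ σ) x
  pointwise zero    = refl
  pointwise (suc x) =
    trans (subst-rename (λ _ → refl) (σ x)) (subst-id (λ _ → refl) (σ x))

es-consumer : ∀ t u m → subst σ u →vsc* consumer m →
              subst σ (t [← u ]) →vsc* subst (consumer m ∷ₛ σ) t
es-consumer {σ} t u m us =
  gmap (subst (exts σ) t [←_]) [←]ʳ-step us ◅◅
  es-step _ (consumer-Value m) (subst-exts-⟪⟫ t) ◅ ε

Consuming-∷ₛ : ∀ {p q m} → q ≤ p → q ≤ m →
               Consuming p σ → Consuming q (consumer m ∷ₛ σ)
Consuming-∷ₛ q≤p q≤m c zero    _ = _ , q≤m , refl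
Consuming-∷ₛ q≤p q≤m c (suc x) x<q
  with m , p≤m , eq ← c x (≤-trans (n≤1+n _) (≤-trans x<q q≤p))
  = m , ≤-trans q≤p p≤m , eq

-- The weight of i[x←i′] or f[x←i′] is split so that the consumer produced by i′
-- is large enough for the body.
split-weight : ∀ a b {n p} → a + b + n ≤ p → b + (a + n) ≤ p
split-weight a b {n} = ≤-trans (≤-reflexive
  (trans (sym (+-assoc b a n)) (cong (_+ n) (+-comm b a))))

-- `n` counts the arguments still to come from outside. The head variable becomes a consumer with
-- capacity at least the current bound; each application uses up one unit and is paid for by its own
-- unit of `weight`.
inert⇒consumer : ∀ {i n p} → Inert i → weight i + n ≤ p → Consuming p σ →
                 ∃[ m ] n ≤ m × subst σ i →vsc* consumer m
-- An abstraction stays a value under any substitution, which is why its `weight` is `0`; variables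
-- and inert terms become consumers.
fireball⇒value : ∀ {f p} → Fireball f → weight f ≤ p → Consuming p σ →
                 ∃[ v ] Value v × subst σ f →vsc* v

inert⇒consumer {n = n} (var x) le c
  with m , p≤m , eq ← c x (≤-trans (m≤m+n (suc x) n) le)
  rewrite eq = m , ≤-trans (m≤n+m n (suc x)) (≤-trans le p≤m) , ε
inert⇒consumer {n = n} (_·_ {i} {f} it fb) le c
  -- The function part keeps room for this argument besides the `n` later ones, so its capacity is a
  -- successor.
  with inert⇒consumer {n = suc n} it
         (≤-trans (≤-trans (≤-reflexive (+-suc (weight i) n))
           (s≤s (≤-trans (m≤n+m _ (weight f))
             (split-weight (weight i) (weight f) ≤-refl)))) le) c
     | fireball⇒value fb
         (≤-trans (≤-trans (m≤n+m (weight f) (suc (weight i))) (m≤m+n _ n)) le) c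
... | suc m , n<m , is | v , val , fs =
  m , s≤s⁻¹ n<m , ·-cong is fs ◅◅ consume m val
inert⇒consumer {n = n} (_[←_] {i} {i′} it it′) le c
  with m , q≤m , is′ ← inert⇒consumer it′ (split-weight (weight i) _ le) c
  -- `≤-refl` makes `weight i + n` the bound for the body; the consumers of the old names and the
  -- new one all meet it.
  with m′ , n≤m′ , is ← inert⇒consumer {n = n} it ≤-refl (Consuming-∷ₛ
         (≤-trans (m≤n+m _ (weight i′)) (split-weight (weight i) _ le)) q≤m c)
  = m′ , n≤m′ , es-consumer i i′ m is′ ◅◅ is

fireball⇒value (value (var x)) le c
  -- `weight (var x)` is `suc x`, so `le` already says `x < p`.
  with m , _ , eq ← c x le
  rewrite eq = consumer m , consumer-Value m , ε
fireball⇒value (value (ƛ t)) le c = _ , ƛ _ , ε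
fireball⇒value (inert it) le c
  with m , _ , is ← inert⇒consumer {n = 0} it
         (≤-trans (≤-reflexive (+-identityʳ _)) le) c
  = consumer m , consumer-Value m , is
fireball⇒value (_[←_] {f} {i} fb it) le c
  with m , q≤m , is ← inert⇒consumer it
         (≤-trans (≤-reflexive (+-comm (weight i) (weight f))) le) c
  with v , val , fs ← fireball⇒value fb ≤-refl
         (Consuming-∷ₛ (≤-trans (m≤m+n _ _) le) q≤m c)
  = v , val , es-consumer f i m is ◅◅ fs

-- Filling the free names

single-bind-≡ : ∀ u x → single u (bind x x) ≡ u
single-bind-≡ u x =
  cong (λ b → single u (if b then 0 else suc x)) (dec-true (x ≟ x) refl)

single-bind-≢ : ∀ u {x y} → y ≢ x → single u (bind x y) ≡ var y
single-bind-≢ u {x} {y} y≢x =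
  cong (λ b → single u (if b then 0 else suc y)) (dec-false (y ≟ x) y≢x)

-- Each name is filled before the next is abstracted, so that for a value `u` one use of `β-value`
-- per name evaluates the context.
fillCtx : Term → ℕ → HeadCtx → HeadCtx
fillCtx u zero    H = H
fillCtx u (suc k) H = (ƛ⟨ k ⟩ fillCtx u k H) · u

fill : Term → ℕ → ℕ → Term
fill u zero    = var
fill u (suc k) = subst (single u ∘ bind k) ∘ fill u k

plugH-fillCtx : ∀ H k → Value u → plugH H t →vsc* t′ →
                plugH (fillCtx u k H) t →vsc* subst (fill u k) t′
plugH-fillCtx {t′ = t′} H zero    val ts =
  transport (_ →vsc*_) (sym (subst-id (λ _ → refl) t′)) ts
plugH-fillCtx {u} {t′ = t′} H (suc k) val ts =
  ·-cong (lam-cong k (plugH-fillCtx H k val ts)) ε ◅◅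
  β-value _ val
    (trans (subst-rename (λ _ → refl) (subst (fill u k) t′))
           (subst-subst (λ _ → refl) t′))

fill-≥ : ∀ u k {x} → k ≤ x → fill u k x ≡ var x
fill-≥ u zero    _ = refl
fill-≥ u (suc k) k<x =
  trans (cong (subst _) (fill-≥ u k (≤-trans (n≤1+n k) k<x)))
        (single-bind-≢ u (≢-sym (<⇒≢ k<x)))

-- Name `x` is untouched until its turn, by `fill-≥`; afterwards its consumer survives the later
-- substitutions because it is closed.
fill-< : ∀ n k {x} → x < k → fill (consumer n) k x ≡ consumer n
fill-< n (suc k) x<1+k with m<1+n⇒m<n∨m≡n x<1+k
... | inj₁ x<k  = trans (cong (subst _) (fill-< n k x<k)) (subst-consumer n)
... | inj₂ refl = trans (cong (subst _) (fill-≥ (consumer n) k ≤-refl))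
                        (single-bind-≡ (consumer n) k)

-- The new argument goes next to `H`, so it is consumed first and the induction absorbs it into the
-- context.
feed : ℕ → HeadCtx → HeadCtx
feed zero    H = H
feed (suc m) H = feed m (H · I)

plugH-feed : ∀ H m → plugH H t →vsc* consumer m → plugH (feed m H) t →vsc* I
plugH-feed H zero    ts = ts
plugH-feed H (suc m) ts =
  plugH-feed (H · I) m (·-cong ts ε ◅◅ consume m (ƛ var 0))

-- The two implications

solvable⇒sol-in : VSC-Solvable t → SOL-IN t
solvable⇒sol-in (H , ts) =
  H · var 0 , var 0 , var 0 , ·-cong ts ε ◅◅ β-value (var 0) (var 0) refl

sol-in⇒solvable : SOL-IN t → VSC-Solvable t
sol-in⇒solvable (H , i , it , ts)
  -- `weight i` serves at once as the number of names filled and as the capacity of each consumer;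
  -- the resulting `m` is the number of copies of `I` to feed.
  with m , _ , is ← inert⇒consumer {n = 0} it
         (≤-reflexive (+-identityʳ (weight i)))
         (λ x x<p → weight i , ≤-refl , fill-< (weight i) (weight i) x<p)
  = feed m H′ ,
    plugH-feed H′ m
      (plugH-fillCtx H (weight i) (consumer-Value (weight i)) ts ◅◅ is)
  where
  H′ = fillCtx (consumer (weight i)) (weight i) H

proposition5p6 : (t : Term) → VSC-Solvable t ⇔ SOL-IN t
proposition5p6 t = mk⇔ solvable⇒sol-in sol-in⇒solvable
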